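{- Let $G$ be a group generated as a monoid by a subset $A\subseteq G$ that is closed under $G$-conjugation, and let $c\in G$. Suppose that $\mathrm{Red}_A(c)$ is finite, that there exists a $c$-compatible order $\prec$ of $A_c$, and that $\mathcal{P}_c(G,A)$ is totally well-covered with respect to $\prec$. Then $\mathcal{P}_c(G,A)$ is chain-connected, Hurwitz-connected and shellable.
   Context: For $x\in G$, $\ell_A(x)$ is the least $k\ge 0$ such that $x=a_1\cdots a_k$ with all $a_i\in A$. Such a factorization with $k=\ell_A(x)$ is a reduced $A$-factorization; $\mathrm{Red}_A(x)$ is the set of these, written as tuples $(a_1,\dots,a_k)$. The $A$-prefix order is $x\le_A y$ iff $\ell_A(x)+\ell_A(x^{ -1}y)=\ell_A(y)$; write $x\lessdot_A y$ for a cover relation. The factorization poset $\mathcal{P}_c=\mathcal{P}_c(G,A)$ is the interval $[e,c]_A=\{x\in G: e\le_A x\le_A c\}$ with the order $\le_A$; it is bounded and graded. $A_c=\{a\in A: a\le_A c\}$. A linear order $\prec$ on $A_c$ is $c$-compatible if every $g\le_A c$ with $\ell_A(g)=2$ has exactly one reduced $A$-factorization $(a,b)$ with $a\preceq b$. For $a\in A_c$ let $F_\prec(a;c)=\{g\in G: a\lessdot_A g\le_A c$ and there is $a'\in A_c$ with $a'\prec a$ and $a'\lessdot_A g\}$. $\mathcal{P}_c$ is well-covered with respect to $\prec$ if $F_\prec(a;c)=\emptyset$ holds exactly when $a=\min_\prec A_c$. It is totally well-covered with respect to $\prec$ if for every $g\in\mathcal{P}_c$ the poset $\mathcal{P}_g$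 is well-covered with respect to the restriction of $\prec$ to $A_g$. For a finite bounded graded poset, the chain graph has the maximal chains as vertices, two being adjacent when they differ in exactly one element; the poset is chain-connected if this graph is connected. With $n=\ell_A(c)$, the braid group $B_n$ acts on $\mathrm{Red}_A(c)$ (Hurwitz action) by $\sigma_i\cdot(a_1,\dots,a_n)=(a_1,\dots,a_{i-1},a_{i+1},a_{i+1}^{ -1}a_ia_{i+1},a_{i+2},\dots,a_n)$. $\mathcal{P}_c$ is Hurwitz-connected if this action is transitive. A finite bounded graded poset is shellable if there is a linear order $\prec$ on its set of maximal chains such that whenever $M\prec M'$ there exist a maximal chain $N\prec M'$ and an element $x\in M'$ with $M\cap M'\subseteq N\cap M'=M'\setminus\{x\}$. -}

module Defs where

open import Data.Nat using (ℕ; _+_; _<_)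
open import Data.List using (List; []; _∷_; length)
open import Data.List.Relation.Unary.All using (All)
open import Data.List.Membership.Propositional using (_∈_; _∉_)
open import Data.Product using (Σ; _×_; _,_)
open import Data.Sum using (_⊎_)
open import Data.Empty using (⊥)
open import Relation.Nullary using (¬_)
open import Relation.Binary.PropositionalEquality using (_≡_; _≢_)
open import Relation.Binary.Construct.Closure.ReflexiveTransitive using (Star)
open import Relation.Binary.Construct.Closure.Symmetric using (SymClosure)

record StrictLinearOn {X : Set} (P : X → Set) (R : X → X → Set) : Set where
  field
    irrefl : ∀ x → P x → ¬ R x x
    trans  : ∀ x y z → P x → P y → P z → R x y → R y z → R x z
    tri    : ∀ x y → P x → P y → R x y ⊎ x ≡ y ⊎ R y x

module Theory {G : Set} (_∙_ : G → G → G) (ε : G) (_⁻¹ : G → G) (A : G → Set) where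

  prod : List G → G
  prod []       = ε
  prod (a ∷ as) = a ∙ prod as

  Fact : G → ℕ → Set
  Fact x k = Σ (List G) λ as → All A as × length as ≡ k × prod as ≡ x

  IsLength : G → ℕ → Set
  IsLength x k = Fact x k × (∀ j → j < k → ¬ Fact x j)

  _≤A_ : G → G → Set
  x ≤A y = Σ ℕ λ k → Σ ℕ λ m →
             IsLength x k × IsLength ((x ⁻¹) ∙ y) m × IsLength y (k + m)

  _<A_ : G → G → Set
  x <A y = x ≤A y × x ≢ y

  _⋖_ : G → G → Set
  x ⋖ y = x <A y × (∀ z → x <A z → z <A y → ⊥)

  IsReduced : G → List G → Set
  IsReduced x as = All A as × prod as ≡ x × IsLength x (length as)

  RedFinite : G → Set
  RedFinite c = Σ (List (List G)) λ L → ∀ as → IsReduced c as → as ∈ L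

  InA : G → G → Set
  InA c a = A a × a ≤A c

  module _ (R : G → G → Set) where

    _⪯_ : G → G → Set
    a ⪯ b = a ≡ b ⊎ R a b

    CCompatible : G → Set
    CCompatible c = ∀ g → g ≤A c → IsLength g 2 →
      Σ G λ a → Σ G λ b →
        (A a × A b × a ∙ b ≡ g × a ⪯ b) ×
        (∀ a' b' → A a' → A b' → a' ∙ b' ≡ g → a' ⪯ b' → a' ≡ a × b' ≡ b)

    InF : G → G → G → Set
    InF a c g = a ⋖ g × g ≤A c × (Σ G λ a' → InA c a' × R a' a × a' ⋖ g)

    FEmpty : G → G → Set
    FEmpty a c = ∀ g → ¬ InF a c g

    IsMin : G → G → Set
    IsMin c a = ∀ b → InA c b → a ⪯ b

    WellCovered : G → Set
    WellCovered c = ∀ a → InA c a → (FEmpty a c → IsMin c a) × (IsMin c a → FEmpty a c)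

    TotallyWellCovered : G → Set
    TotallyWellCovered c = ∀ g → ε ≤A g → g ≤A c → WellCovered g

  data SatChain (y : G) : G → List G → Set where
    done : SatChain y y (y ∷ [])
    step : ∀ {x z zs} → x ⋖ z → SatChain y z zs → SatChain y x (x ∷ zs)

  -- maximal chains of P_c = [e, c]_A
  MaxChain : G → List G → Set
  MaxChain c M = SatChain c ε M

  DifferInOne : List G → List G → Set
  DifferInOne M M' = Σ G λ x → x ∈ M × x ∉ M' × (∀ y → y ∈ M → y ∉ M' → y ≡ x)

  ChainEdge : G → List G → List G → Set
  ChainEdge c M M' = MaxChain c M × MaxChain c M' × DifferInOne M M'

  ChainConnected : G → Set
  ChainConnected c = ∀ M M' → MaxChain c M → MaxChain c M' → Star (ChainEdge c) M M'

  data σ-step : List G → List G → Set where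
    here  : ∀ {a b as} → σ-step (a ∷ b ∷ as) (b ∷ (((b ⁻¹) ∙ a) ∙ b) ∷ as)
    there : ∀ {x as bs} → σ-step as bs → σ-step (x ∷ as) (x ∷ bs)

  HurwitzConnected : G → Set
  HurwitzConnected c = ∀ as bs → IsReduced c as → IsReduced c bs →
                       Star (SymClosure σ-step) as bs

  Shellable : G → Set₁
  Shellable c = Σ (List G → List G → Set) λ R →
    StrictLinearOn (MaxChain c) R ×
    (∀ M M' → MaxChain c M → MaxChain c M' → R M M' →
      Σ (List G) λ N → Σ G λ x →
        MaxChain c N × R N M' × x ∈ M' ×
        (∀ y → y ∈ M → y ∈ M' → y ∈ N) ×
        (∀ y → (y ∈ N × y ∈ M' → y ∈ M' × y ≢ x) × (y ∈ M' × y ≢ x → y ∈ N × y ∈ M')))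

{-# OPTIONS --safe #-}
-- Call a reduced factorization rising if its consecutive letters are weakly
-- increasing for ≺.  The heart of the matter is that the first letter of a
-- rising reduced factorization (a, b, …) of g ≤ c is min A_g: by induction
-- b = min A_{a⁻¹g}, so (a, d) is rising for every ad ≤ g of length two.  Any other
-- factorization of ad can be sorted by Hurwitz moves, which only decrease its
-- first letter, so compatibility forbids a first letter a' ≺ a; hence
-- F(a; g) = ∅, and a is the minimum because P_g is well-covered.
-- Consequently rising factorizations are unique.  Bubble sort by Hurwitz moves
-- reaches them, which gives Hurwitz-connectedness and, since a move changes one
-- element of the corresponding chain, chain-connectedness.  For shellability
-- order chains lexicographically by their labels.  If M ≺ M', then right after
-- their first difference M' has a first descent, at an element outside of M,
-- and swapping that descent gives N.
module Submission where

open import Defs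
open import Level using (0ℓ)
open import Data.Nat using (ℕ; zero; suc; _+_; _<_; z≤n; s≤s)
open import Data.Nat.Properties
  using (+-suc; +-comm; +-assoc; +-identityʳ; +-monoˡ-<; +-monoʳ-<; <-cmp; m≢1+m+n;
         m<m+n; ≤⇒≯; suc-injective)
open import Data.List using (List; []; _∷_; _++_; length)
open import Data.List.Properties
  using (length-++; ++-assoc; ∷-injectiveˡ; ∷-injectiveʳ;
         length-removeAt′)
open import Data.List.Relation.Unary.All as All using (All; []; _∷_)
open import Data.List.Relation.Unary.All.Properties using (++⁺; ++⁻ˡ; ++⁻ʳ)
open import Data.List.Relation.Unary.Any using (here; there; _─_)
open import Data.List.Relation.Unary.Linked as Linked using (Linked; []; [-]; _∷_)
open import Data.List.Membership.Propositional using (_∈_; _∉_)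
open import Data.Product using (Σ; _×_; _,_; proj₁; proj₂)
open import Data.Sum using (_⊎_; inj₁; inj₂)
open import Function using (_∘_)
open import Relation.Nullary using (¬_; contradiction)
open import Relation.Binary.Definitions using (tri<; tri≈; tri>)
open import Relation.Binary.PropositionalEquality
  using (_≡_; _≢_; refl; sym; trans; cong; cong₂; subst; module ≡-Reasoning)
open import Relation.Binary.Construct.Closure.ReflexiveTransitive as Star
  using (Star; _◅_; _◅◅_) renaming (ε to nil)
open import Relation.Binary.Construct.Closure.Symmetric as Sym using (fwd)
open import Induction.WellFounded using (Acc; acc)
open import Algebra.Bundles using (Group)
open import Algebra.Structures using (IsGroup)
import Algebra.Properties.Group as GroupProperties

-- Lists and the lexicographic order

module _ {X : Set} where

  ∈-─ : ∀ {v w : X} {xs} (i : v ∈ xs) → w ≢ v → w ∈ xs → w ∈ (xs ─ i)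
  ∈-─ (here refl) w≢v (here refl) = contradiction refl w≢v
  ∈-─ (here refl) w≢v (there j)   = j
  ∈-─ {xs = _ ∷ _ ∷ _} (there i) w≢v (here refl) = here refl
  ∈-─ {xs = _ ∷ _ ∷ _} (there i) w≢v (there j)   = there (∈-─ i w≢v j)

  ++-injectiveˡ : ∀ (us ws : List X) {vs zs} →
    us ++ vs ≡ ws ++ zs → length us ≡ length ws → us ≡ ws
  ++-injectiveˡ []       []       eq l = refl
  ++-injectiveˡ (u ∷ us) (w ∷ ws) eq l =
    cong₂ _∷_ (∷-injectiveˡ eq) (++-injectiveˡ us ws (∷-injectiveʳ eq) (suc-injective l))

  -- A list and a proper prefix of it are incomparable. The label sequences of maximal chains all
  -- have the same length, so trichotomy survives.
  data Lex (R : X → X → Set) : List X → List X → Set where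
    here  : ∀ {x y xs ys} → R x y → Lex R (x ∷ xs) (y ∷ ys)
    there : ∀ {x xs ys} → Lex R xs ys → Lex R (x ∷ xs) (x ∷ ys)

  Lex-++ : ∀ {R : X → X → Set} us {xs ys} → Lex R xs ys → Lex R (us ++ xs) (us ++ ys)
  Lex-++ []       l = l
  Lex-++ (u ∷ us) l = there (Lex-++ us l)

  module _ {P : X → Set} {R : X → X → Set} (linear : StrictLinearOn P R) where
    private module R = StrictLinearOn linear

    Lex-irrefl : ∀ {xs} → All P xs → ¬ Lex R xs xs
    Lex-irrefl (p ∷ ps) (here r)  = R.irrefl _ p r
    Lex-irrefl (p ∷ ps) (there l) = Lex-irrefl ps l

    Lex-trans : ∀ {xs ys zs} → All P xs → All P ys → All P zs →
                Lex R xs ys → Lex R ys zs → Lex R xs zs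
    Lex-trans (p ∷ _)  (q ∷ _)  (r ∷ _)  (here s)  (here t)  = here (R.trans _ _ _ p q r s t)
    Lex-trans _        _        _        (here s)  (there m) = here s
    Lex-trans _        _        _        (there l) (here t)  = here t
    Lex-trans (_ ∷ ps) (_ ∷ qs) (_ ∷ rs) (there l) (there m) = there (Lex-trans ps qs rs l m)

    Lex-tri : ∀ {xs ys} → All P xs → All P ys → length xs ≡ length ys →
              Lex R xs ys ⊎ xs ≡ ys ⊎ Lex R ys xs
    Lex-tri []       []       _ = inj₂ (inj₁ refl)
    Lex-tri (p ∷ ps) (q ∷ qs) e with R.tri _ _ p q
    ... | inj₁ r         = inj₁ (here r)
    ... | inj₂ (inj₂ r)  = inj₂ (inj₂ (here r))
    ... | inj₂ (inj₁ refl) with Lex-tri ps qs (suc-injective e)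
    ...   | inj₁ l         = inj₁ (there l)
    ...   | inj₂ (inj₁ eq) = inj₂ (inj₁ (cong (_ ∷_) eq))
    ...   | inj₂ (inj₂ l)  = inj₂ (inj₂ (there l))

module GeneratedGroup {G : Set} (_∙_ : G → G → G) (ε : G) (_⁻¹ : G → G)
  (isGroup : IsGroup _≡_ _∙_ ε _⁻¹) (A : G → Set)
  (conj : ∀ a g → A a → A (((g ⁻¹) ∙ a) ∙ g)) where

  open Theory _∙_ ε _⁻¹ A
  open IsGroup isGroup using (assoc; identityˡ; identityʳ; inverseˡ)

  group : Group 0ℓ 0ℓ
  group = record { isGroup = isGroup }

  open GroupProperties group using (∙-cancelˡ; \\-leftDividesˡ; \\-leftDividesʳ)

  -- Factorizations and lengths

  prod-++ : ∀ as bs → prod (as ++ bs) ≡ prod as ∙ prod bs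
  prod-++ []       bs = sym (identityˡ _)
  prod-++ (a ∷ as) bs = trans (cong (a ∙_) (prod-++ as bs)) (sym (assoc _ _ _))

  fact-list : ∀ {as} → All A as → Fact (prod as) (length as)
  fact-list {as} ps = as , ps , refl , refl

  fact-letter : ∀ {a} → A a → Fact a 1
  fact-letter {a} p = a ∷ [] , p ∷ [] , refl , identityʳ a

  fact-∙ : ∀ {x y k m} → Fact x k → Fact y m → Fact (x ∙ y) (k + m)
  fact-∙ (as , ps , refl , refl) (bs , qs , refl , refl) =
    as ++ bs , ++⁺ ps qs , length-++ as , prod-++ as bs

  length-unique : ∀ {x k m} → IsLength x k → IsLength x m → k ≡ m
  length-unique {k = k} {m} (fk , mink) (fm , minm) with <-cmp k m
  ... | tri< k<m _ _ = contradiction fk (minm k k<m)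
  ... | tri≈ _ k≡m _ = k≡m
  ... | tri> _ _ m<k = contradiction fm (mink m m<k)

  length-ε : IsLength ε 0
  length-ε = ([] , [] , refl , refl) , λ _ ()

  length-zero : ∀ {x} → IsLength x 0 → x ≡ ε
  length-zero (([] , _ , _ , eq) , _) = sym eq

  -- A shorter factorization of one factor, joined to the given one of the other, would shorten the
  -- product.
  length-split : ∀ {x y k m} → Fact x k → Fact y m → IsLength (x ∙ y) (k + m) →
                 IsLength x k × IsLength y m
  length-split {k = k} {m} fx fy (_ , min) =
    (fx , λ j j<k f → min (j + m) (+-monoˡ-< m j<k) (fact-∙ f fy)) ,
    (fy , λ j j<m f → min (k + j) (+-monoʳ-< k j<m) (fact-∙ fx f))

  split-≤ : ∀ {x y k m} → Fact x k → Fact y m → IsLength (x ∙ y) (k + m) → x ≤A (x ∙ y)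
  split-≤ {x} {y} {k} {m} fx fy l =
    k , m , proj₁ ls , subst (λ z → IsLength z m) (sym (\\-leftDividesʳ x y)) (proj₂ ls) , l
    where ls = length-split fx fy l

  ≤A-length : ∀ {x y} → x ≤A y → Σ ℕ (IsLength y)
  ≤A-length (k , m , _ , _ , l) = k + m , l

  ≤A-refl : ∀ {x k} → IsLength x k → x ≤A x
  ≤A-refl {x} {k} l =
    k , 0 , l , subst (λ z → IsLength z 0) (sym (inverseˡ x)) length-ε ,
    subst (IsLength x) (sym (+-identityʳ k)) l

  ε-≤A : ∀ {x k} → IsLength x k → ε ≤A x
  ε-≤A {x} {k} l =
    subst (ε ≤A_) (identityˡ x)
      (split-≤ (proj₁ length-ε) (proj₁ l) (subst (λ z → IsLength z k) (sym (identityˡ x)) l))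

  -- The quotient of `z` by `x` is the product of the two given quotients, with `m + m'` letters,
  -- and the lengths add up.
  ≤A-trans : ∀ {x y z} → x ≤A y → y ≤A z → x ≤A z
  ≤A-trans {x} {y} {z} (k , m , lx , lxy , ly) (k' , m' , ly' , lyz , lz)
    with refl ← length-unique ly' ly =
    subst (x ≤A_) x∙w≡z
      (split-≤ (proj₁ lx) (fact-∙ (proj₁ lxy) (proj₁ lyz))
        (subst (λ t → IsLength t (k + (m + m'))) (sym x∙w≡z)
          (subst (IsLength z) (+-assoc k m m') lz)))
    where
    x∙w≡z : x ∙ (((x ⁻¹) ∙ y) ∙ ((y ⁻¹) ∙ z)) ≡ z
    x∙w≡z = begin
      x ∙ (((x ⁻¹) ∙ y) ∙ ((y ⁻¹) ∙ z)) ≡⟨ cong (x ∙_) (assoc _ _ _) ⟩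
      x ∙ ((x ⁻¹) ∙ (y ∙ ((y ⁻¹) ∙ z))) ≡⟨ \\-leftDividesˡ x _ ⟩
      y ∙ ((y ⁻¹) ∙ z)                  ≡⟨ \\-leftDividesˡ y z ⟩
      z ∎
      where open ≡-Reasoning

  <A-length : ∀ {x y k m} → x <A y → IsLength x k → IsLength y m → k < m
  <A-length {x} {y} ((k , zero , _ , lxy , _) , x≢y) _ _ =
    contradiction
      (trans (sym (identityʳ x)) (trans (cong (x ∙_) (sym (length-zero lxy))) (\\-leftDividesˡ x y)))
      x≢y
  <A-length ((k , suc m , lx , _ , ly) , _) lx' ly'
    with refl ← length-unique lx' lx | refl ← length-unique ly' ly = m<m+n k (s≤s z≤n)

  split-< : ∀ {x y k m} → Fact x k → Fact y (suc m) → IsLength (x ∙ y) (k + suc m) → x <A (x ∙ y)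
  split-< {x} {y} {k} {m} fx fy l =
    split-≤ fx fy l ,
    λ eq → m≢1+m+n k (trans (length-unique (proj₁ (length-split fx fy l))
                                            (subst (λ z → IsLength z (k + suc m)) (sym eq) l))
                            (+-suc k m))

  -- An element strictly between would have length strictly between `k` and `k + 1`.
  ⋖-letter : ∀ {x a k} → Fact x k → A a → IsLength (x ∙ a) (k + 1) → x ⋖ (x ∙ a)
  ⋖-letter {x} {a} {k} fx p l =
    split-< fx (fact-letter p) l ,
    λ z x<z z<xa → let _ , lz = ≤A-length (proj₁ x<z) in
      ≤⇒≯ (<A-length x<z (proj₁ (length-split fx (fact-letter p) l)) lz)
        (subst (proj₁ (≤A-length (proj₁ x<z)) <_) (+-comm k 1) (<A-length z<xa lz l))

  -- A reduced factorization of the quotient has exactly one letter: with none, `x ≡ z`; with two or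
  -- more, `x ∙ a` for its first letter `a` lies strictly between.
  ⋖-length : ∀ {x z} → x ⋖ z → Σ ℕ λ k → IsLength x k × IsLength z (suc k) × A ((x ⁻¹) ∙ z)
  ⋖-length {x} {z} (((k , _ , _ , (([] , _ , _ , eq) , _) , _) , x≢z) , _) =
    contradiction (trans (sym (identityʳ x)) (trans (cong (x ∙_) eq) (\\-leftDividesˡ x z))) x≢z
  ⋖-length {x} {z} (((k , _ , lx , ((a ∷ [] , p ∷ [] , refl , eq) , _) , lz) , _) , _) =
    k , lx , subst (IsLength z) (+-comm k 1) lz , subst A (trans (sym (identityʳ a)) eq) p
  ⋖-length {x} {z} (((k , _ , lx , ((a ∷ b ∷ as , p ∷ q ∷ ps , refl , eq) , _) , lz) , _) , cov) =
    contradiction (subst ((x ∙ a) <A_) xab≡z xa<z) (cov (x ∙ a) x<xa)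
    where
    xab≡z : (x ∙ a) ∙ prod (b ∷ as) ≡ z
    xab≡z = trans (assoc _ _ _) (trans (cong (x ∙_) eq) (\\-leftDividesˡ x z))
    fxa  = fact-∙ (proj₁ lx) (fact-letter p)
    fbas = fact-list (q ∷ ps)
    l : IsLength ((x ∙ a) ∙ prod (b ∷ as)) ((k + 1) + suc (length as))
    l = subst (λ t → IsLength t _) (sym xab≡z) (subst (IsLength z) (sym (+-assoc k 1 _)) lz)
    xa<z = split-< fxa fbas l
    x<xa = split-< (proj₁ lx) (fact-letter p) (proj₁ (length-split fxa fbas l))

  -- Reduced words and their factors

  Reduced : List G → Set
  Reduced as = IsReduced (prod as) as

  isReduced⇒Reduced : ∀ {g as} → IsReduced g as → Reduced as
  isReduced⇒Reduced (ps , refl , l) = ps , refl , l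

  reduced-tail : ∀ {a as} → Reduced (a ∷ as) → Reduced as
  reduced-tail (p ∷ ps , _ , l) =
    ps , refl , proj₂ (length-split (fact-letter p) (fact-list ps) l)

  reduced-++ˡ : ∀ as {bs} → Reduced (as ++ bs) → Reduced as × prod as ≤A prod (as ++ bs)
  reduced-++ˡ as {bs} (ps , _ , l) =
    (pas , refl , proj₁ (length-split (fact-list pas) (fact-list pbs) l')) ,
    subst (prod as ≤A_) (sym (prod-++ as bs)) (split-≤ (fact-list pas) (fact-list pbs) l')
    where
    pas = ++⁻ˡ as ps
    pbs = ++⁻ʳ as ps
    l' : IsLength (prod as ∙ prod bs) (length as + length bs)
    l' = subst (λ g → IsLength g _) (prod-++ as bs) (subst (IsLength _) (length-++ as) l)

  head-≤ : ∀ {a as} → Reduced (a ∷ as) → a ≤A prod (a ∷ as)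
  head-≤ (p ∷ ps , _ , l) = split-≤ (fact-letter p) (fact-list ps) l

  -- a g = g (g⁻¹ a g)
  tail-≤ : ∀ {a as} → Reduced (a ∷ as) → prod as ≤A prod (a ∷ as)
  tail-≤ {a} {as} (p ∷ ps , _ , l) =
    subst (prod as ≤A_) eq
      (split-≤ (fact-list ps) (fact-letter (conj a (prod as) p))
        (subst (λ g → IsLength g _) (sym eq) (subst (IsLength _) (+-comm 1 (length as)) l)))
    where
    eq : prod as ∙ (((prod as ⁻¹) ∙ a) ∙ prod as) ≡ a ∙ prod as
    eq = trans (cong (prod as ∙_) (assoc _ _ _)) (\\-leftDividesˡ _ _)

  -- Both prefixes are reduced, so each has the length of the common element. Thus an element
  -- determines its position in any chain through it.
  prefix-length : ∀ us ws {vs zs} → Reduced (us ++ vs) → Reduced (ws ++ zs) →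
                  prod us ≡ prod ws → length us ≡ length ws
  prefix-length us ws ru rw eq =
    length-unique (proj₂ (proj₂ (proj₁ (reduced-++ˡ us ru))))
      (subst (λ g → IsLength g _) (sym eq) (proj₂ (proj₂ (proj₁ (reduced-++ˡ ws rw)))))

  Reduced-cong : ∀ {as bs} → All A bs → length as ≡ length bs → prod as ≡ prod bs →
                 Reduced as → Reduced bs
  Reduced-cong ps len eq (_ , _ , l) =
    ps , refl , subst (λ g → IsLength g _) eq (subst (IsLength _) len l)

  -- Hurwitz moves

  hurwitz-prod : ∀ a b → b ∙ (((b ⁻¹) ∙ a) ∙ b) ≡ a ∙ b
  hurwitz-prod a b = trans (cong (b ∙_) (assoc _ _ _)) (\\-leftDividesˡ b _)

  σ-prod : ∀ {as bs} → σ-step as bs → prod as ≡ prod bs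
  σ-prod (here {a} {b} {as}) =
    trans (sym (assoc _ _ _)) (trans (cong (_∙ prod as) (sym (hurwitz-prod a b))) (assoc _ _ _))
  σ-prod (there s)      = cong (_ ∙_) (σ-prod s)

  σ-length : ∀ {as bs} → σ-step as bs → length as ≡ length bs
  σ-length here      = refl
  σ-length (there s) = cong suc (σ-length s)

  σ*-prod : ∀ {as bs} → Star σ-step as bs → prod as ≡ prod bs
  σ*-prod nil      = refl
  σ*-prod (s ◅ ss) = trans (σ-prod s) (σ*-prod ss)

  σ*-length : ∀ {as bs} → Star σ-step as bs → length as ≡ length bs
  σ*-length nil      = refl
  σ*-length (s ◅ ss) = trans (σ-length s) (σ*-length ss)

  σ-All : ∀ {as bs} → σ-step as bs → All A as → All A bs
  σ-All (here {a} {b}) (p ∷ q ∷ ps) = q ∷ conj a b p ∷ ps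
  σ-All (there s)      (p ∷ ps)     = p ∷ σ-All s ps

  σ-reduced : ∀ {g as bs} → σ-step as bs → IsReduced g as → IsReduced g bs
  σ-reduced s (ps , eq , l) =
    σ-All s ps , trans (sym (σ-prod s)) eq , subst (IsLength _) (σ-length s) l

  σ*-reduced : ∀ {g as bs} → Star σ-step as bs → IsReduced g as → IsReduced g bs
  σ*-reduced nil      r = r
  σ*-reduced (s ◅ ss) r = σ*-reduced ss (σ-reduced s r)

  -- Maximal chains as sequences of partial products

  chain : G → List G → List G
  chain x []       = x ∷ []
  chain x (a ∷ as) = x ∷ chain (x ∙ a) as

  labels : List G → List G
  labels []           = []
  labels (x ∷ [])     = []
  labels (x ∷ y ∷ zs) = ((x ⁻¹) ∙ y) ∷ labels (y ∷ zs)

  labels-chain : ∀ x as → labels (chain x as) ≡ as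
  labels-chain x []           = refl
  labels-chain x (a ∷ [])     = cong (_∷ []) (\\-leftDividesʳ x a)
  labels-chain x (a ∷ b ∷ as) = cong₂ _∷_ (\\-leftDividesʳ x a) (labels-chain (x ∙ a) (b ∷ as))

  -- Additivity of the lengths passes to every prefix, so `⋖-letter` applies at each letter.
  chain-saturated : ∀ {x k} as → All A as → Fact x k → IsLength (x ∙ prod as) (k + length as) →
                    SatChain (x ∙ prod as) x (chain x as)
  chain-saturated {x} [] [] fx l =
    subst (λ y → SatChain y x (x ∷ [])) (sym (identityʳ x)) done
  chain-saturated {x} {k} (a ∷ as) (p ∷ ps) fx l =
    step (⋖-letter fx p (proj₁ (length-split fxa (fact-list ps) l')))
      (subst (λ y → SatChain y (x ∙ a) (chain (x ∙ a) as)) (assoc _ _ _) (chain-saturated as ps fxa l'))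
    where
    fxa = fact-∙ fx (fact-letter p)
    l' : IsLength ((x ∙ a) ∙ prod as) ((k + 1) + length as)
    l' = subst (λ y → IsLength y _) (sym (assoc _ _ _)) (subst (IsLength _) (sym (+-assoc k 1 _)) l)

  -- Each cover contributes one letter and raises the length by one. The last component records this
  -- count; for `x = ε` it says that the word is reduced.
  saturated-chain : ∀ {x y M} → SatChain y x M → Σ (List G) λ as →
    All A as × M ≡ chain x as × x ∙ prod as ≡ y ×
    (∀ k → IsLength x k → IsLength y (k + length as))
  saturated-chain done =
    [] , [] , refl , identityʳ _ , λ k l → subst (IsLength _) (sym (+-identityʳ k)) l
  saturated-chain {x} {y} (step {z = z} x⋖z s) with saturated-chain s | ⋖-length x⋖z
  ... | as , ps , refl , refl , len | k , lx , lz , p =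
    ((x ⁻¹) ∙ z) ∷ as , p ∷ ps ,
    cong (λ t → x ∷ chain t as) (sym (\\-leftDividesˡ x z)) ,
    trans (sym (assoc _ _ _)) (cong (_∙ prod as) (\\-leftDividesˡ x z)) ,
    λ k' lx' → subst (IsLength _) (trans (cong (λ j → suc j + _) (length-unique lx lx')) (sym (+-suc k' _)))
                 (len (suc k) lz)

  reduced⇒maxChain : ∀ {c as} → IsReduced c as → MaxChain c (chain ε as)
  reduced⇒maxChain {as = as} (ps , refl , l) =
    subst (λ y → SatChain y ε (chain ε as)) (identityˡ _)
      (chain-saturated as ps (proj₁ length-ε) (subst (λ y → IsLength y _) (sym (identityˡ _)) l))

  maxChain⇒reduced : ∀ {c M} → MaxChain c M → Σ (List G) λ as → M ≡ chain ε as × IsReduced c as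
  maxChain⇒reduced s with saturated-chain s
  ... | as , ps , eq , pr , len = as , eq , ps , trans (sym (identityˡ _)) pr , len 0 length-ε

  ∈-chain⇒prefix : ∀ {x y} as → y ∈ chain x as →
    Σ (List G) λ us → Σ (List G) λ vs → as ≡ us ++ vs × y ≡ x ∙ prod us
  ∈-chain⇒prefix []       (here refl) = [] , [] , refl , sym (identityʳ _)
  ∈-chain⇒prefix (a ∷ as) (here refl) = [] , a ∷ as , refl , sym (identityʳ _)
  ∈-chain⇒prefix (a ∷ as) (there i) with ∈-chain⇒prefix as i
  ... | us , vs , refl , refl = a ∷ us , vs , refl , assoc _ _ _

  head∈chain : ∀ x as → x ∈ chain x as
  head∈chain x []      = here refl
  head∈chain x (_ ∷ _) = here refl

  prefix∈chain : ∀ {x} us vs → x ∙ prod us ∈ chain x (us ++ vs)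
  prefix∈chain {x} [] vs = subst (_∈ chain x vs) (sym (identityʳ x)) (head∈chain x vs)
  prefix∈chain {x} (a ∷ us) vs =
    there (subst (_∈ chain (x ∙ a) (us ++ vs)) (assoc _ _ _) (prefix∈chain us vs))

  -- Changing two adjacent letters

  module _ {a b a' b' : G} (ab≡a'b' : a ∙ b ≡ a' ∙ b') where

    swap-prod : ∀ pre post → prod (pre ++ a ∷ b ∷ post) ≡ prod (pre ++ a' ∷ b' ∷ post)
    swap-prod [] post =
      trans (sym (assoc _ _ _)) (trans (cong (_∙ prod post) ab≡a'b') (assoc _ _ _))
    swap-prod (c ∷ pre) post = cong (c ∙_) (swap-prod pre post)

    -- Partial products inside `pre` do not change, and those from `b` on agree because
    -- `a ∙ b ≡ a' ∙ b'`. Only the one that ends in `a` can be lost.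
    swap-∈ : ∀ {x y} pre {post} → y ∈ chain x (pre ++ a ∷ b ∷ post) →
             y ≡ x ∙ prod (pre ++ a ∷ []) ⊎ y ∈ chain x (pre ++ a' ∷ b' ∷ post)
    swap-∈ []       (here refl) = inj₂ (here refl)
    swap-∈ {x} []   (there (here refl)) = inj₁ (cong (x ∙_) (sym (identityʳ a)))
    swap-∈ {x} {y} [] {post} (there (there i)) = inj₂ (there (there (subst (λ t → y ∈ chain t post) eq i)))
      where
      eq : (x ∙ a) ∙ b ≡ (x ∙ a') ∙ b'
      eq = trans (assoc _ _ _) (trans (cong (x ∙_) ab≡a'b') (sym (assoc _ _ _)))
    swap-∈ (c ∷ pre) (here refl) = inj₂ (here refl)
    swap-∈ (c ∷ pre) (there i) with swap-∈ pre i
    ... | inj₁ eq = inj₁ (trans eq (assoc _ _ _))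
    ... | inj₂ j  = inj₂ (there j)

    -- By `prefix-length` the element could occur only right after `pre` and `a'`; cancelling
    -- `prod pre` would then give `a ≡ a'`.
    swap-∉ : ∀ {x} pre {post} → a ≢ a' → Reduced (pre ++ a ∷ b ∷ post) →
             Reduced (pre ++ a' ∷ b' ∷ post) → x ∙ prod (pre ++ a ∷ []) ∉ chain x (pre ++ a' ∷ b' ∷ post)
    swap-∉ {x} pre {post} a≢a' r r' i with ∈-chain⇒prefix (pre ++ a' ∷ b' ∷ post) i
    ... | us , vs , eq , xeq = a≢a' (last-eq (++-injectiveˡ us (pre ++ a' ∷ []) eq' len))
      where
      peq : prod (pre ++ a ∷ []) ≡ prod us
      peq = ∙-cancelˡ x _ _ xeq
      eq' : us ++ vs ≡ (pre ++ a' ∷ []) ++ b' ∷ post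
      eq' = trans (sym eq) (sym (++-assoc pre _ _))
      len : length us ≡ length (pre ++ a' ∷ [])
      len = trans
        (prefix-length us (pre ++ a ∷ []) (subst Reduced eq r')
          (subst Reduced (sym (++-assoc pre _ _)) r) (sym peq))
        (trans (length-++ pre) (sym (length-++ pre)))
      last-eq : us ≡ pre ++ a' ∷ [] → a ≡ a'
      last-eq refl = trans (sym (identityʳ a)) (trans (∙-cancelˡ (prod pre) _ _
        (trans (sym (prod-++ pre _)) (trans peq (prod-++ pre _)))) (identityʳ a'))

  -- Unlike `σ-step` this is symmetric, and `a ≢ a'` rules out moves that fix the word, so every
  -- swap of reduced words is an edge of the chain graph.
  data Swap : List G → List G → Set where
    swap : ∀ pre {a b a' b'} post → a ∙ b ≡ a' ∙ b' → a ≢ a' →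
           Swap (pre ++ a ∷ b ∷ post) (pre ++ a' ∷ b' ∷ post)

  Swap-∷ : ∀ {c as bs} → Swap as bs → Swap (c ∷ as) (c ∷ bs)
  Swap-∷ (swap pre post eq a≢a') = swap (_ ∷ pre) post eq a≢a'

  SwapIn : G → List G → List G → Set
  SwapIn c as bs = IsReduced c as × IsReduced c bs × Swap as bs

  SwapIn-sym : ∀ {c as bs} → SwapIn c as bs → SwapIn c bs as
  SwapIn-sym (r , r' , swap pre post eq a≢a') = r' , r , swap pre post (sym eq) (a≢a' ∘ sym)

  swap⇒edge : ∀ {c as bs} → SwapIn c as bs → ChainEdge c (chain ε as) (chain ε bs)
  swap⇒edge {c} (r , r' , swap pre {a} {b} {a'} {b'} post eq a≢a') =
    reduced⇒maxChain r , reduced⇒maxChain r' , ε ∙ prod (pre ++ a ∷ []) ,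
    subst (λ as → ε ∙ prod (pre ++ a ∷ []) ∈ chain ε as) (++-assoc pre _ _)
      (prefix∈chain (pre ++ a ∷ []) (b ∷ post)) ,
    swap-∉ eq pre a≢a' (isReduced⇒Reduced r) (isReduced⇒Reduced r') ,
    unique
    where
    unique : ∀ y → y ∈ chain ε (pre ++ a ∷ b ∷ post) → y ∉ chain ε (pre ++ a' ∷ b' ∷ post) →
             y ≡ ε ∙ prod (pre ++ a ∷ [])
    unique y i y∉ with swap-∈ eq pre i
    ... | inj₁ e = e
    ... | inj₂ j = contradiction j y∉

  module WellCoveredOrder (c : G) (finite : RedFinite c) (R : G → G → Set)
    (linear : StrictLinearOn (InA c) R) (compatible : CCompatible R c)
    (wellCovered : TotallyWellCovered R c) where

    private module R = StrictLinearOn linear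

    _⊑_ : G → G → Set
    _⊑_ = _⪯_ R

    -- Words below `c` and their letters

    Below : List G → Set
    Below as = Reduced as × prod as ≤A c

    isReduced⇒Below : ∀ {as} → IsReduced c as → Below as
    isReduced⇒Below (ps , refl , l) = (ps , refl , l) , ≤A-refl l

    -- Closure of `A` under conjugation enters here, through `tail-≤`: a suffix of a reduced word is
    -- also a prefix of its product in the order `≤A`.
    below-tail : ∀ {a as} → Below (a ∷ as) → Below as
    below-tail (r , le) = reduced-tail r , ≤A-trans (tail-≤ r) le

    below-prefix : ∀ as {bs} → Below (as ++ bs) → Below as
    below-prefix as (r , le) with reduced-++ˡ as r
    ... | r' , le' = r' , ≤A-trans le' le

    below-σ : ∀ {as bs} → σ-step as bs → Below as → Below bs
    below-σ s (r , le) = isReduced⇒Reduced (σ-reduced s r) , subst (_≤A c) (σ-prod s) le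

    below-σ* : ∀ {as bs} → Star σ-step as bs → Below as → Below bs
    below-σ* nil      r = r
    below-σ* (s ◅ ss) r = below-σ* ss (below-σ s r)

    -- The witness is a whole factorization of `c`, not just `InA c a`, since it is an entry of the
    -- list in `finite`, and that list is what `≺-acc` shrinks.
    Atom : G → Set
    Atom a = Σ (List G) λ as → IsReduced c (a ∷ as)

    atom⇒InA : ∀ {a} → Atom a → InA c a
    atom⇒InA (as , r@(p ∷ _ , refl , _)) = p , head-≤ (isReduced⇒Reduced r)

    -- The word is completed to a factorization of `c` by a reduced factorization `bs` of the
    -- remaining quotient.
    head-atom : ∀ {a as} → Below (a ∷ as) → Atom a
    head-atom {a} {as} ((ps , _ , l) , (k , m , lk , ((bs , qs , refl , eq) , _) , lc)) =
      as ++ bs , ++⁺ ps qs ,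
      trans (prod-++ (a ∷ as) bs) (trans (cong (_ ∙_) eq) (\\-leftDividesˡ _ c)) ,
      subst (IsLength c) (trans (cong (_+ length bs) (length-unique lk l)) (sym (length-++ (a ∷ as)))) lc

    letters-InA : ∀ {as} → Below as → All (InA c) as
    letters-InA {[]}     _ = []
    letters-InA {a ∷ as} b = atom⇒InA (head-atom b) ∷ letters-InA (below-tail b)

    -- The order on atoms

    ⊑-trans : ∀ {x y z} → Atom x → Atom y → Atom z → x ⊑ y → y ⊑ z → x ⊑ z
    ⊑-trans _ _ _ (inj₁ refl) q           = q
    ⊑-trans _ _ _ (inj₂ p)    (inj₁ refl) = inj₂ p
    ⊑-trans x y z (inj₂ p)    (inj₂ q)    =
      inj₂ (R.trans _ _ _ (atom⇒InA x) (atom⇒InA y) (atom⇒InA z) p q)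

    ⊑⇒≯ : ∀ {x y} → Atom x → Atom y → x ⊑ y → ¬ R y x
    ⊑⇒≯ x y (inj₁ refl) q = R.irrefl _ (atom⇒InA x) q
    ⊑⇒≯ x y (inj₂ p)    q =
      R.irrefl _ (atom⇒InA x) (R.trans _ _ _ (atom⇒InA x) (atom⇒InA y) (atom⇒InA x) p q)

    ⊑-antisym : ∀ {x y} → Atom x → Atom y → x ⊑ y → y ⊑ x → x ≡ y
    ⊑-antisym x y p (inj₁ refl) = refl
    ⊑-antisym x y p (inj₂ q)    = contradiction q (⊑⇒≯ x y p)

    ⊑-or-> : ∀ {x y} → Atom x → Atom y → x ⊑ y ⊎ R y x
    ⊑-or-> x y with R.tri _ _ (atom⇒InA x) (atom⇒InA y)
    ... | inj₁ p        = inj₁ (inj₂ p)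
    ... | inj₂ (inj₁ e) = inj₁ (inj₁ e)
    ... | inj₂ (inj₂ q) = inj₂ q

    -- Accessibility ranges over all predecessors, while `R` is known to be an order only on
    -- `InA c`; hence the smaller side must be an atom.
    _≺_ : G → G → Set
    x ≺ y = Atom x × R x y

    -- Atoms are not known to form a decidable set; instead, the list that
    -- contains the reduced factorizations loses an entry at each descent.
    ≺-acc : ∀ n L → length L ≡ n → ∀ {y} → Atom y →
            (∀ x as → IsReduced c (x ∷ as) → R x y → (x ∷ as) ∈ L) → Acc _≺_ y
    ≺-acc zero [] refl atomY cover =
      acc λ { ((as , r) , x≺y) → contradiction (cover _ as r x≺y) λ () }
    ≺-acc (suc n) L len {y} atomY cover = acc smaller
      where
      smaller : ∀ {x} → x ≺ y → Acc _≺_ x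
      smaller {x} (atomX@(as , r) , x≺y) =
        ≺-acc n (L ─ i) (suc-injective (trans (sym (length-removeAt′ L _)) len)) atomX
          λ z bs s z≺x → ∈-─ i
            (λ { refl → R.irrefl _ (atom⇒InA atomX) z≺x })
            (cover z bs s (R.trans _ _ _ (atom⇒InA (bs , s)) (atom⇒InA atomX) (atom⇒InA atomY) z≺x x≺y))
        where i = cover x as r x≺y

    ≺-accessible : ∀ {x} → Atom x → Acc _≺_ x
    ≺-accessible atomX = ≺-acc _ (proj₁ finite) refl atomX λ x as r _ → proj₂ finite (x ∷ as) r

    -- Rising factorizations

    -- If `q` precedes `p`, a Hurwitz move brings `q` to the front. The first letter strictly
    -- decreases, so by accessibility the pair becomes rising.
    sort-pair : ∀ {p q} → Acc _≺_ p → Below (p ∷ q ∷ []) →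
      Σ G λ p' → Σ G λ q' → Star σ-step (p ∷ q ∷ []) (p' ∷ q' ∷ []) × p' ⊑ q' × p' ⊑ p
    sort-pair {p} {q} (acc rs) b with ⊑-or-> (head-atom b) (head-atom (below-tail b))
    ... | inj₁ p⊑q = p , q , nil , p⊑q , inj₁ refl
    ... | inj₂ q≺p with sort-pair (rs (head-atom (below-tail b) , q≺p)) (below-σ here b)
    ...   | p' , q' , ss , p'⊑q' , p'⊑q =
      p' , q' , here ◅ ss , p'⊑q' ,
      ⊑-trans (head-atom (below-σ* (here ◅ ss) b)) (head-atom (below-tail b)) (head-atom b)
        p'⊑q (inj₂ q≺p)

    rising-pair-unique : ∀ {p q p' q'} → Below (p ∷ q ∷ []) → Below (p' ∷ q' ∷ []) →
      prod (p ∷ q ∷ []) ≡ prod (p' ∷ q' ∷ []) → p ⊑ q → p' ⊑ q' → p ≡ p'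
    rising-pair-unique {p} {q} {p'} {q'} ((P ∷ Q ∷ [] , _ , l) , le) ((P' ∷ Q' ∷ [] , _) , _) eq r r'
      with compatible _ le l
    ... | a , b , _ , unique =
      trans (proj₁ (unique p q P Q (cong (p ∙_) (sym (identityʳ q))) r))
        (sym (proj₁ (unique p' q' P' Q' (trans (cong (p' ∙_) (sym (identityʳ q'))) (sym eq)) r')))

    -- Sorting the second pair gives a rising pair whose first letter is at most `a'`. By
    -- compatibility that letter is `a`, so `a'` cannot precede `a`.
    no-smaller-atom : ∀ {a d a' d'} → Below (a ∷ d ∷ []) → Below (a' ∷ d' ∷ []) →
      prod (a ∷ d ∷ []) ≡ prod (a' ∷ d' ∷ []) → a ⊑ d → ¬ R a' a
    no-smaller-atom b b' eq a⊑d a'≺a with sort-pair (≺-accessible (head-atom b')) b'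
    ... | p , q , ss , p⊑q , p⊑a'
      with refl ← rising-pair-unique b (below-σ* ss b') (trans eq (σ*-prod ss)) a⊑d p⊑q =
      ⊑⇒≯ (head-atom b) (head-atom b') p⊑a' a'≺a

    below-pair : ∀ {a h} → A a → A ((a ⁻¹) ∙ h) → IsLength h 2 → h ≤A c →
                 Below (a ∷ ((a ⁻¹) ∙ h) ∷ []) × prod (a ∷ ((a ⁻¹) ∙ h) ∷ []) ≡ h
    below-pair {a} {h} p q l le =
      ((p ∷ q ∷ [] , refl , subst (λ g → IsLength g 2) (sym eq) l) , subst (_≤A c) (sym eq) le) , eq
      where
      eq : prod (a ∷ ((a ⁻¹) ∙ h) ∷ []) ≡ h
      eq = trans (cong (a ∙_) (identityʳ _)) (\\-leftDividesˡ a h)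

    rising⇒min : ∀ {a as} → Below (a ∷ as) → Linked _⊑_ (a ∷ as) → IsMin R (prod (a ∷ as)) a
    rising⇒min {a} {as} b@(r@(pa ∷ ps , _ , lg) , g≤c) linked =
      proj₁ (wellCovered g (ε-≤A lg) g≤c a (pa , head-≤ r)) F-empty
      where
      g = prod (a ∷ as)
      la : IsLength a 1
      la = proj₁ (length-split (fact-letter pa) (fact-list ps) lg)

      F-empty : FEmpty R a g
      F-empty h (a⋖h , h≤g@(_ , _ , lh' , ((es , qs , refl , eqe) , _) , lg') ,
                 a' , (pa' , _) , a'≺a , a'⋖h)
        with ⋖-length a⋖h | ⋖-length a'⋖h
      ... | k , lk , lh , pd | k' , lk' , lhk' , pd'
        -- Since `a` has length one, its cover `h` has length two; so `h` is `a` times a letter `d`,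
        -- and also `a'` times a letter.
        with refl ← length-unique lk la
        with refl ← length-unique lh' lh
        with refl ← length-unique lhk' lh
        with below-pair pa pd lh (≤A-trans h≤g g≤c) | below-pair pa' pd' lh (≤A-trans h≤g g≤c)
      ... | bd , eqd | bd' , eqd' =
        no-smaller-atom bd bd' (trans eqd (sym eqd')) (a⊑d as linked b tail-prod lg') a'≺a
        where
        d = (a ⁻¹) ∙ h
        h∙es : a ∙ (d ∙ prod es) ≡ g
        h∙es = trans (sym (assoc _ _ _)) (trans (cong (_∙ prod es) (\\-leftDividesˡ a h))
                 (trans (cong (h ∙_) eqe) (\\-leftDividesˡ h g)))
        tail-prod : prod (d ∷ es) ≡ prod as
        tail-prod = ∙-cancelˡ a _ _ h∙es

        -- If `as` is empty, `g` is too short to lie above `h`. Otherwise `d ∷ es` is a reduced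
        -- factorization of `prod as`, so `d` is at least the letter `x`, which is minimal there by
        -- recursion on the rising tail.
        a⊑d : ∀ as → Linked _⊑_ (a ∷ as) → Below (a ∷ as) → prod (d ∷ es) ≡ prod as →
              IsLength (prod (a ∷ as)) (2 + length es) → a ⊑ d
        a⊑d [] _ ((_ , _ , l) , _) _ l' = contradiction (length-unique l l') λ ()
        a⊑d (x ∷ xs) (a⊑x ∷ rest) b eq l' =
          ⊑-trans (head-atom b) (head-atom (below-tail b)) (head-atom bt) a⊑x
            (rising⇒min (below-tail b) rest d
              (pd , subst (d ≤A_) eq (head-≤ (proj₁ bt))))
          where
          bt : Below (d ∷ es)
          bt = below-tail (Reduced-cong (pa ∷ pd ∷ qs) (length-unique (proj₂ (proj₂ (proj₁ b))) l')
                 (cong (a ∙_) (sym eq)) (proj₁ b) ,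
                 subst (_≤A c) (cong (a ∙_) (sym eq)) (proj₂ b))

    rising-head-≤ : ∀ {a b as bs} → Below (a ∷ as) → Linked _⊑_ (a ∷ as) → Below (b ∷ bs) →
                    prod (b ∷ bs) ≡ prod (a ∷ as) → a ⊑ b
    rising-head-≤ ba la ((p ∷ ps , eq , l) , _) e =
      rising⇒min ba la _ (p , subst (_ ≤A_) e (head-≤ (p ∷ ps , eq , l)))

    -- Both first letters are minimal among the letters below the common product, hence equal;
    -- cancelling them leaves the tails.
    rising-unique : ∀ {as bs} → Below as → Below bs → prod as ≡ prod bs →
                    Linked _⊑_ as → Linked _⊑_ bs → as ≡ bs
    rising-unique {as} {bs} ra rb eq =
      go ra rb eq (length-unique (proj₂ (proj₂ (proj₁ ra)))
        (subst (λ g → IsLength g _) (sym eq) (proj₂ (proj₂ (proj₁ rb)))))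
      where
      go : ∀ {as bs} → Below as → Below bs → prod as ≡ prod bs → length as ≡ length bs →
           Linked _⊑_ as → Linked _⊑_ bs → as ≡ bs
      go {[]}     {[]}     _  _  _  _ _  _  = refl
      go {a ∷ as} {b ∷ bs} ba bb eq e la lb
        with refl ← ⊑-antisym (head-atom ba) (head-atom bb)
                      (rising-head-≤ ba la bb (sym eq)) (rising-head-≤ bb lb ba eq) =
        cong (a ∷_) (go (below-tail ba) (below-tail bb) (∙-cancelˡ a _ _ eq) (suc-injective e)
          (Linked.tail la) (Linked.tail lb))

    -- Bubble sort by Hurwitz moves

    σ*-∷ : ∀ {a as bs} → Star σ-step as bs → Star σ-step (a ∷ as) (a ∷ bs)
    σ*-∷ = Star.gmap (_ ∷_) there

    mutual
      sort : ∀ n as → length as ≡ n → Below as →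
             Σ (List G) λ bs → Linked _⊑_ bs × Star σ-step as bs
      sort zero    []       _  _ = [] , [] , nil
      sort (suc n) (a ∷ as) e b = insert n a as (suc-injective e) (≺-accessible (head-atom b)) b

      insert : ∀ n a as → length as ≡ n → Acc _≺_ a → Below (a ∷ as) →
               Σ (List G) λ bs → Linked _⊑_ bs × Star σ-step (a ∷ as) bs
      insert n a as e (acc rs) b with sort n as e (below-tail b)
      ... | []     , _  , ss = a ∷ [] , [-] , σ*-∷ ss
      ... | m ∷ ms , lm , ss with b' ← below-σ* (σ*-∷ ss) b
        with ⊑-or-> (head-atom b') (head-atom (below-tail b'))
      ...   | inj₁ a⊑m = a ∷ m ∷ ms , a⊑m ∷ lm , σ*-∷ ss
      -- After the move the tail begins with a conjugate of `a` and need not be rising, so insertion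
      -- starts afresh. The length `n` stays, but the first letter has dropped from `a` to `m`.
      ...   | inj₂ m≺a with insert n m _ (trans (sym (σ*-length ss)) e)
                               (rs (head-atom (below-tail b') , m≺a)) (below-σ here b')
      ...     | bs , lb , ts = bs , lb , σ*-∷ ss ◅◅ (here ◅ ts)

    -- Hurwitz-connectedness and chain-connectedness

    rising-form : ∀ {as bs} → IsReduced c as → IsReduced c bs →
                  Σ (List G) λ ds → Star σ-step as ds × Star σ-step bs ds
    rising-form {as} {bs} ra rb
      with sort _ as refl (isReduced⇒Below ra) | sort _ bs refl (isReduced⇒Below rb)
    ... | as' , la , sa | bs' , lb , sb
      with ra' ← σ*-reduced sa ra | rb' ← σ*-reduced sb rb
      with refl ← rising-unique (isReduced⇒Below ra') (isReduced⇒Below rb')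
                    (trans (proj₁ (proj₂ ra')) (sym (proj₁ (proj₂ rb')))) la lb =
      as' , sa , sb

    hurwitzConnected : HurwitzConnected c
    hurwitzConnected as bs ra rb with rising-form ra rb
    ... | ds , sa , sb = Star.map fwd sa ◅◅ Star.reverse (Sym.symmetric _) (Star.map fwd sb)

    -- Trichotomy of `R` decides whether the two moved letters are equal. If they are, the move
    -- fixes the word, as a letter commutes with itself.
    σ⇒swap : ∀ {as bs} → σ-step as bs → Below as → as ≡ bs ⊎ Swap as bs
    σ⇒swap (here {a} {b} {as}) below
      with R.tri _ _ (atom⇒InA (head-atom below)) (atom⇒InA (head-atom (below-tail below)))
    ... | inj₁ a≺b = inj₂ (swap [] as (sym (hurwitz-prod a b))
                        λ { refl → R.irrefl _ (atom⇒InA (head-atom below)) a≺b })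
    ... | inj₂ (inj₂ b≺a) = inj₂ (swap [] as (sym (hurwitz-prod a b))
                        λ { refl → R.irrefl _ (atom⇒InA (head-atom below)) b≺a })
    ... | inj₂ (inj₁ refl) =
      inj₁ (cong (λ x → a ∷ x ∷ as) (sym (trans (cong (_∙ a) (inverseˡ a)) (identityˡ a))))
    σ⇒swap (there s) below with σ⇒swap s (below-tail below)
    ... | inj₁ refl = inj₁ refl
    ... | inj₂ t    = inj₂ (Swap-∷ t)

    σ*⇒swaps : ∀ {as bs} → Star σ-step as bs → IsReduced c as → Star (SwapIn c) as bs
    σ*⇒swaps nil      r = nil
    σ*⇒swaps (s ◅ ss) r with r' ← σ-reduced s r with σ⇒swap s (isReduced⇒Below r)
    ... | inj₁ refl = σ*⇒swaps ss r'
    ... | inj₂ t    = (r , r' , t) ◅ σ*⇒swaps ss r'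

    chainConnected : ChainConnected c
    chainConnected M M' m m' with maxChain⇒reduced m | maxChain⇒reduced m'
    ... | as , refl , ra | bs , refl , rb with rising-form ra rb
    ...   | ds , sa , sb =
      Star.gmap (chain ε) swap⇒edge
        (σ*⇒swaps sa ra ◅◅ Star.reverse SwapIn-sym (σ*⇒swaps sb rb))

    -- Shelling

    -- The rising prefix ends in `p`, which makes this the first descent of the word.
    Descent : List G → Set
    Descent bs = Σ (List G) λ pre → Σ G λ p → Σ G λ q → Σ (List G) λ post →
                   bs ≡ pre ++ p ∷ q ∷ post × R q p × Linked _⊑_ (pre ++ p ∷ [])

    rising-or-descent : ∀ bs → Below bs → Linked _⊑_ bs ⊎ Descent bs
    rising-or-descent []           _ = inj₁ []
    rising-or-descent (x ∷ [])     _ = inj₁ [-]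
    rising-or-descent (x ∷ y ∷ bs) b
      with rising-or-descent (y ∷ bs) (below-tail b)
         | ⊑-or-> (head-atom b) (head-atom (below-tail b))
    ... | _      | inj₂ y≺x = inj₂ ([] , x , y , bs , refl , y≺x , [-])
    ... | inj₁ l | inj₁ x⊑y = inj₁ (x⊑y ∷ l)
    ... | inj₂ ([] , p , q , post , refl , q≺p , l) | inj₁ x⊑y =
      inj₂ (x ∷ [] , p , q , post , refl , q≺p , x⊑y ∷ l)
    ... | inj₂ (z ∷ pre , p , q , post , refl , q≺p , l) | inj₁ x⊑y =
      inj₂ (x ∷ z ∷ pre , p , q , post , refl , q≺p , x⊑y ∷ l)

    -- The common start `x` of the two chains is arbitrary so that the recursion can pass over
    -- common letters.
    ShellingDescent : G → List G → List G → Set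
    ShellingDescent x as bs = Σ (List G) λ pre → Σ G λ p → Σ G λ q → Σ (List G) λ post →
      bs ≡ pre ++ p ∷ q ∷ post × R q p × x ∙ prod (pre ++ p ∷ []) ∉ chain x as

    -- Otherwise the element is also the product of a prefix that begins with `a`; this prefix is
    -- nonempty by its length. As `b ∷ bs` is rising, `b` would be at most `a`.
    rising-prefix-∉ : ∀ {x a as b bs vs} → Below (a ∷ as) → Below ((b ∷ bs) ++ vs) →
      Linked _⊑_ (b ∷ bs) → R a b → x ∙ prod (b ∷ bs) ∉ chain x (a ∷ as)
    rising-prefix-∉ {x} {a} {as} {b} {bs} ba bb l a≺b i with ∈-chain⇒prefix (a ∷ as) i
    ... | us , ws , eq , xeq
      with peq ← ∙-cancelˡ x _ _ xeq
      with us | eq | peq | prefix-length us (b ∷ bs) (subst Reduced eq (proj₁ ba)) (proj₁ bb) (sym peq)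
    ... | _ ∷ us' | refl | peq | _ =
      ⊑⇒≯ (head-atom bb) (head-atom ba)
        (rising-head-≤ (below-prefix (b ∷ bs) bb) l (below-prefix (a ∷ us') ba) (sym peq)) a≺b

    shelling-descent : ∀ {x as bs} → Below as → Below bs → prod as ≡ prod bs →
                       Lex R as bs → ShellingDescent x as bs
    shelling-descent ba bb eq (here a≺b) with rising-or-descent _ bb
    -- A rising `bs` would have the least possible first letter, against `a≺b`.
    ... | inj₁ l = contradiction a≺b (⊑⇒≯ (head-atom bb) (head-atom ba) (rising-head-≤ bb l ba eq))
    ... | inj₂ ([] , p , q , post , refl , q≺p , l) =
      [] , p , q , post , refl , q≺p , rising-prefix-∉ ba bb l a≺b
    ... | inj₂ (z ∷ pre , p , q , post , refl , q≺p , l) =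
      z ∷ pre , p , q , post , refl , q≺p ,
      rising-prefix-∉ ba (subst Below (sym (++-assoc (z ∷ pre) _ _)) bb) l a≺b
    shelling-descent {x} {a ∷ as} ba bb eq (there lex)
      with shelling-descent {x ∙ a} (below-tail ba) (below-tail bb) (∙-cancelˡ a _ _ eq) lex
    ... | pre , p , q , post , refl , q≺p , z∉ = a ∷ pre , p , q , post , refl , q≺p , z∉'
      where
      z∉' : x ∙ prod (a ∷ pre ++ p ∷ []) ∉ chain x (a ∷ as)
      -- The only new element of the chain is its start, the partial product of the empty prefix,
      -- whereas the prefix ending in `p` has positive length.
      z∉' (here e) = contradiction
        (prefix-length (a ∷ pre ++ p ∷ []) [] (subst Reduced (sym (++-assoc (a ∷ pre) _ _)) (proj₁ bb))
          (proj₁ bb) (∙-cancelˡ x _ _ (trans e (sym (identityʳ x))))) λ ()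
      z∉' (there i) = z∉ (subst (_∈ chain (x ∙ a) as) (sym (assoc _ _ _)) i)

    σ-++ : ∀ pre {as bs} → σ-step as bs → σ-step (pre ++ as) (pre ++ bs)
    σ-++ []        s = s
    σ-++ (x ∷ pre) s = there (σ-++ pre s)

    _≺ᶜ_ : List G → List G → Set
    M ≺ᶜ M' = Lex R (labels M) (labels M')

    lex⇒≺ᶜ : ∀ {as bs} → Lex R as bs → chain ε as ≺ᶜ chain ε bs
    lex⇒≺ᶜ {as} {bs} l
      rewrite labels-chain ε as | labels-chain ε bs = l

    ≺ᶜ⇒lex : ∀ {as bs} → chain ε as ≺ᶜ chain ε bs → Lex R as bs
    ≺ᶜ⇒lex {as} {bs} l
      rewrite labels-chain ε as | labels-chain ε bs = l

    labels-InA : ∀ {M} → MaxChain c M → All (InA c) (labels M)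
    labels-InA m with maxChain⇒reduced m
    ... | as , refl , r =
      subst (All (InA c)) (sym (labels-chain ε as)) (letters-InA (isReduced⇒Below r))

    ≺ᶜ-linear : StrictLinearOn (MaxChain c) _≺ᶜ_
    ≺ᶜ-linear = record
      { irrefl = λ M m → Lex-irrefl linear (labels-InA m)
      ; trans  = λ M M' M'' m m' m'' →
          Lex-trans linear (labels-InA m) (labels-InA m') (labels-InA m'')
      ; tri    = tri
      }
      where
      tri : ∀ M M' → MaxChain c M → MaxChain c M' → M ≺ᶜ M' ⊎ M ≡ M' ⊎ M' ≺ᶜ M
      tri M M' m m' with maxChain⇒reduced m | maxChain⇒reduced m'
      ... | as , refl , ra | bs , refl , rb
        with Lex-tri linear (letters-InA (isReduced⇒Below ra)) (letters-InA (isReduced⇒Below rb))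
               (length-unique (proj₂ (proj₂ ra)) (proj₂ (proj₂ rb)))
      ...   | inj₁ l           = inj₁ (lex⇒≺ᶜ l)
      ...   | inj₂ (inj₁ refl) = inj₂ (inj₁ refl)
      ...   | inj₂ (inj₂ l)    = inj₂ (inj₂ (lex⇒≺ᶜ l))

    shellable : Shellable c
    shellable = _≺ᶜ_ , ≺ᶜ-linear , shelling
      where
      shelling : ∀ M M' → MaxChain c M → MaxChain c M' → M ≺ᶜ M' →
        Σ (List G) λ N → Σ G λ x →
          MaxChain c N × N ≺ᶜ M' × x ∈ M' ×
          (∀ y → y ∈ M → y ∈ M' → y ∈ N) ×
          (∀ y → (y ∈ N × y ∈ M' → y ∈ M' × y ≢ x) × (y ∈ M' × y ≢ x → y ∈ N × y ∈ M'))
      shelling M M' m m' M≺M' with maxChain⇒reduced m | maxChain⇒reduced m'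
      ... | as , refl , ra | bs , refl , rb
        with shelling-descent {ε} (isReduced⇒Below ra) (isReduced⇒Below rb)
               (trans (proj₁ (proj₂ ra)) (sym (proj₁ (proj₂ rb)))) (≺ᶜ⇒lex M≺M')
      ... | pre , p , q , post , refl , q≺p , x∉M =
        chain ε ns , x , reduced⇒maxChain rn , lex⇒≺ᶜ (Lex-++ pre (here q≺p)) ,
        x∈M' ,
        -- `x` is the only element of the second chain that `N` lacks, and it does not lie on the
        -- first.
        (λ y y∈M y∈M' → ∈N y∈M' λ { refl → x∉M y∈M }) ,
        λ y → (λ { (y∈N , y∈M') → y∈M' , λ { refl → x∉N y∈N } }) ,
               λ { (y∈M' , y≢x) → ∈N y∈M' y≢x , y∈M' }
        where
        r  = ((q ⁻¹) ∙ p) ∙ q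
        -- The Hurwitz move at the descent replaces `p` by the smaller `q` at the first place where
        -- the words differ, so this chain comes earlier.
        ns = pre ++ q ∷ r ∷ post
        x  = ε ∙ prod (pre ++ p ∷ [])
        pq≡qr : p ∙ q ≡ q ∙ r
        pq≡qr = sym (hurwitz-prod p q)
        rn : IsReduced c ns
        rn = σ-reduced (σ-++ pre here) rb
        x∈M' : x ∈ chain ε (pre ++ p ∷ q ∷ post)
        x∈M' = subst (λ bs → x ∈ chain ε bs) (++-assoc pre _ _) (prefix∈chain (pre ++ p ∷ []) (q ∷ post))
        p≢q : p ≢ q
        p≢q refl = R.irrefl p (All.head (++⁻ʳ pre (letters-InA (isReduced⇒Below rb)))) q≺p
        x∉N : x ∉ chain ε ns
        x∉N = swap-∉ pq≡qr pre p≢q (isReduced⇒Reduced rb) (isReduced⇒Reduced rn)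
        ∈N : ∀ {y} → y ∈ chain ε (pre ++ p ∷ q ∷ post) → y ≢ x → y ∈ chain ε ns
        ∈N y∈ y≢x with swap-∈ pq≡qr pre y∈
        ... | inj₁ e = contradiction e y≢x
        ... | inj₂ i = i

theorem1p1 : {G : Set} (_∙_ : G → G → G) (ε : G) (_⁻¹ : G → G) →
    IsGroup _≡_ _∙_ ε _⁻¹ →
    (A : G → Set) →
    let open Theory _∙_ ε _⁻¹ A in
    (∀ x → Σ ℕ (Fact x)) →
    (∀ a g → A a → A (((g ⁻¹) ∙ a) ∙ g)) →
    (c : G) →
    RedFinite c →
    (R : G → G → Set) →
    StrictLinearOn (InA c) R →
    CCompatible R c →
    TotallyWellCovered R c →
    ChainConnected c × HurwitzConnected c × Shellable c
theorem1p1 _∙_ ε _⁻¹ isGroup A _ conj c finite R linear compatible wellCovered =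
  chainConnected , hurwitzConnected , shellable
  where
  open GeneratedGroup _∙_ ε _⁻¹ isGroup A conj
  open WellCoveredOrder c finite R linear compatible wellCovered
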